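{- (i) $A\vdash_{\mathbf{RJ}}B$ iff $A\vdash B$ is true in all RJ-models. (ii) $A\vdash_{\mathbf{RC}}B$ iff $A\vdash B$ is true in all RC-models. (iii) $A\vdash_{\mathbf{RC\omega}}B$ iff $A\vdash B$ is true in all persistent RC-models.
   Context: Strictly positive formulas: $A::= p\mid \top\mid (A\land B)\mid \alpha A$, $\alpha\le\omega$. $\mathbf{RJ}$: $A\vdash A$; $A\vdash\top$; cut; $A\land B\vdash A$; $A\land B\vdash B$; from $A\vdash B$, $A\vdash C$ infer $A\vdash B\land C$; from $A\vdash B$ infer $\alpha A\vdash\alpha B$; $\alpha\alpha A\vdash\alpha A$; $\alpha\beta A\vdash\beta A$, $\beta\alpha A\vdash\beta A$ for $\alpha\ge\beta$; $\alpha A\land\beta B\vdash\alpha(A\land\beta B)$ for $\alpha>\beta$. $\mathbf{RC}=\mathbf{RJ}+\{\alpha A\vdash\beta A:\alpha>\beta\}$; $\mathbf{RC\omega}=\mathbf{RC}+\{\omega A\vdash A\}$. A Kripke model for signature $S\subseteq\{0,1,\dots,\omega\}$ is a nonempty set $W$ with relations $(R_\alpha)_{\alpha\in S}$ and a valuation of variables; $x\Vdash\top$; $x\Vdash A\land B$ iff both; $x\Vdash\alpha A$ iff $\exists y(xR_\alpha y\wedge y\Vdash A)$. An RJ$_S$-frame satisfies $R_\alpha R_\beta\subseteq R_{\min(\alpha,\beta)}$ (i.e. $xR_\alpha yR_\beta z\Rightarrow xR_{\min(\alpha,\beta)}z$) for all $\alpha,\beta\in S$, and, for $\alpha>\beta$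 in $S$, $xR_\alpha y$ and $xR_\beta z$ imply $yR_\beta z$. An RC$_S$-frame is an RJ$_S$-frame with $R_\alpha\subseteq R_\beta$ for $\beta<\alpha$ in $S$. RJ-/RC-models are those with $S=\{0,1,\dots,\omega\}$. A model is persistent if $x\Vdash p$ and $yR_\omega x$ imply $y\Vdash p$ for each variable $p$. A sequent $A\vdash B$ is true in a model if every node forcing $A$ forces $B$. -}

module Defs where

open import Data.Nat.Base using (ℕ; _<_; _≤_)
open import Data.Nat.Properties using (≤-isTotalOrder)
open import Data.Product.Base using (∃-syntax; _×_)
open import Data.Unit.Polymorphic.Base using () renaming (⊤ to Unit)
open import Level using (Level) renaming (suc to lsuc)
open import Relation.Binary.Bundles using (TotalOrder)
open import Relation.Nullary.Construct.Add.Supremum using (_⁺; ⊤⁺)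
open import Relation.Binary.Construct.Add.Supremum.NonStrict _≤_ using (_≤⁺_; ≤⁺-isTotalOrder-≡)
open import Relation.Binary.Construct.Add.Supremum.Strict _<_ using (_<⁺_)

-- Ordinals α ≤ ω: ℕ with a top element ω adjoined.
Modality : Set
Modality = ℕ ⁺

ω : Modality
ω = ⊤⁺

modalityOrder : TotalOrder _ _ _
modalityOrder = record { isTotalOrder = ≤⁺-isTotalOrder-≡ ≤-isTotalOrder }

open import Algebra.Construct.NaturalChoice.Min modalityOrder public using (_⊓_)

infixr 8 ⟨_⟩_
infixr 7 _∧_

data Formula : Set where
  var  : ℕ → Formula
  ⊤    : Formula
  _∧_  : Formula → Formula → Formula
  ⟨_⟩_ : Modality → Formula → Formula

-- A set of sequents, read as additional axioms A ⊢ B.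
Axioms : Set₁
Axioms = Formula → Formula → Set

infix 4 RJ+_∋_⊢_

-- RJ+ Ax ∋ A ⊢ B : the sequent A ⊢ B is derivable in RJ extended by Ax.
data RJ+_∋_⊢_ (Ax : Axioms) : Formula → Formula → Set where
  axiom : ∀ {A B} → Ax A B → RJ+ Ax ∋ A ⊢ B
  refl  : ∀ {A} → RJ+ Ax ∋ A ⊢ A
  top   : ∀ {A} → RJ+ Ax ∋ A ⊢ ⊤
  cut   : ∀ {A B C} → RJ+ Ax ∋ A ⊢ B → RJ+ Ax ∋ B ⊢ C → RJ+ Ax ∋ A ⊢ C
  ∧-el  : ∀ {A B} → RJ+ Ax ∋ A ∧ B ⊢ A
  ∧-er  : ∀ {A B} → RJ+ Ax ∋ A ∧ B ⊢ B
  ∧-i   : ∀ {A B C} → RJ+ Ax ∋ A ⊢ B → RJ+ Ax ∋ A ⊢ C → RJ+ Ax ∋ A ⊢ B ∧ C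
  nec   : ∀ {α A B} → RJ+ Ax ∋ A ⊢ B → RJ+ Ax ∋ ⟨ α ⟩ A ⊢ ⟨ α ⟩ B
  trans : ∀ {α A} → RJ+ Ax ∋ ⟨ α ⟩ ⟨ α ⟩ A ⊢ ⟨ α ⟩ A
  absˡ  : ∀ {α β A} → β ≤⁺ α → RJ+ Ax ∋ ⟨ α ⟩ ⟨ β ⟩ A ⊢ ⟨ β ⟩ A
  absʳ  : ∀ {α β A} → β ≤⁺ α → RJ+ Ax ∋ ⟨ β ⟩ ⟨ α ⟩ A ⊢ ⟨ β ⟩ A
  J     : ∀ {α β A B} → β <⁺ α → RJ+ Ax ∋ ⟨ α ⟩ A ∧ ⟨ β ⟩ B ⊢ ⟨ α ⟩ (A ∧ ⟨ β ⟩ B)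

data ∅-Axioms : Axioms where

data RC-Axioms : Axioms where
  mono : ∀ {α β A} → β <⁺ α → RC-Axioms (⟨ α ⟩ A) (⟨ β ⟩ A)

data RCω-Axioms : Axioms where
  rc   : ∀ {A B} → RC-Axioms A B → RCω-Axioms A B
  pers : ∀ {A} → RCω-Axioms (⟨ ω ⟩ A) A

infix 4 _⊢RJ_ _⊢RC_ _⊢RCω_

_⊢RJ_ _⊢RC_ _⊢RCω_ : Formula → Formula → Set
A ⊢RJ B  = RJ+ ∅-Axioms ∋ A ⊢ B
A ⊢RC B  = RJ+ RC-Axioms ∋ A ⊢ B
A ⊢RCω B = RJ+ RCω-Axioms ∋ A ⊢ B

-- Kripke models for the full signature {0, 1, …, ω}.
record Model (ℓ : Level) : Set (lsuc ℓ) where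
  field
    W        : Set ℓ
    nonempty : W
    R        : Modality → W → W → Set ℓ
    V        : W → ℕ → Set ℓ

module _ {ℓ : Level} (M : Model ℓ) where
  open Model M

  infix 4 _⊩_

  _⊩_ : W → Formula → Set ℓ
  x ⊩ var p   = V x p
  x ⊩ ⊤       = Unit
  x ⊩ A ∧ B   = (x ⊩ A) × (x ⊩ B)
  x ⊩ ⟨ α ⟩ A = ∃[ y ] (R α x y × (y ⊩ A))

  True : Formula → Formula → Set ℓ
  True A B = ∀ x → x ⊩ A → x ⊩ B

  record IsRJ : Set ℓ where
    field
      comp : ∀ {α β x y z} → R α x y → R β y z → R (α ⊓ β) x z
      eucl : ∀ {α β x y z} → β <⁺ α → R α x y → R β x z → R β y z

  record IsRC : Set ℓ where
    field
      isRJ : IsRJ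
      incl : ∀ {α β x y} → β <⁺ α → R α x y → R β x y

  Persistent : Set ℓ
  Persistent = ∀ {p x y} → V x p → R ω y x → V y p

{-# OPTIONS --safe #-}
-- Completeness is proved with a canonical model over an arbitrary extension of
-- RJ.  Its points are theories, with x Rα y when C ∈ y implies αC ∈ x and, for
-- β < α, βC ∈ x implies βC ∈ y.  If αA ∈ x, then the theory y generated by A and
-- all βC ∈ x with β < α is an Rα-successor of x: iterating J gives
-- αA ∧ D ⊢ α(A ∧ D) for every finite conjunction D of such βC.
-- Arbitrary sets of formulas would live in Set₁, whereas a model at level zero
-- needs worlds in Set; hence only theories built from finitely generated ones by
-- the step x ↦ y above are used, and these are given by inductive codes.
module Submission where

open import Data.Nat.Base using (_<_; _≤_)
open import Data.Nat.Properties using (<-≤-trans; <⇒≤)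
open import Data.Product.Base using (_×_; _,_; ∃-syntax)
open import Data.Sum.Base using (inj₁; inj₂)
open import Data.Unit.Polymorphic.Base using (tt)
open import Function.Bundles using (_⇔_; mk⇔)
open import Level using (Level; Lift; lift; lower)
open import Relation.Binary.Bundles using (module TotalOrder)
open import Relation.Binary.Construct.Add.Supremum.NonStrict _≤_ using (_≤⁺_; _≤⊤⁺; [_])
open import Relation.Binary.Construct.Add.Supremum.Strict _<_ using (_<⁺_; <⁺-transˡ; [_]; [_]<⊤⁺)
open import Relation.Binary.PropositionalEquality.Core using (subst)
open import Defs
open import Algebra.Construct.NaturalChoice.Min modalityOrder using (x≤y⇒x⊓y≈x; x≤y⇒y⊓x≈x; x⊓y≤x; x⊓y≤y)

open TotalOrder modalityOrder using (total) renaming (refl to ≤⁺-refl)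

<⁺⇒≤⁺ : ∀ {α β} → α <⁺ β → α ≤⁺ β
<⁺⇒≤⁺ [ m<n ]   = [ <⇒≤ m<n ]
<⁺⇒≤⁺ [ m ]<⊤⁺ = _ ≤⊤⁺

<⁺-≤⁺-trans : ∀ {α β γ} → α <⁺ β → β ≤⁺ γ → α <⁺ γ
<⁺-≤⁺-trans = <⁺-transˡ <-≤-trans

module Soundness {ℓ} {M : Model ℓ} (isRJ : IsRJ M) where
  open Model M
  open IsRJ isRJ

  comp-≥ : ∀ {α β x y z} → β ≤⁺ α → R α x y → R β y z → R β x z
  comp-≥ {x = x} {z = z} β≤α xy yz = subst (λ γ → R γ x z) (x≤y⇒y⊓x≈x β≤α) (comp xy yz)

  comp-≤ : ∀ {α β x y z} → α ≤⁺ β → R α x y → R β y z → R α x z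
  comp-≤ {x = x} {z = z} α≤β xy yz = subst (λ γ → R γ x z) (x≤y⇒x⊓y≈x α≤β) (comp xy yz)

  sound : ∀ {Ax} → (∀ {A B} → Ax A B → True M A B) → ∀ {A B} → RJ+ Ax ∋ A ⊢ B → True M A B
  sound ax (axiom a)  x f                            = ax a x f
  sound ax refl       x f                            = f
  sound ax top        x f                            = tt
  sound ax (cut d e)  x f                            = sound ax e x (sound ax d x f)
  sound ax ∧-el       x (f , g)                      = f
  sound ax ∧-er       x (f , g)                      = g
  sound ax (∧-i d e)  x f                            = sound ax d x f , sound ax e x f
  sound ax (nec d)    x (y , xy , f)                 = y , xy , sound ax d y f
  sound ax trans      x (y , xy , z , yz , f)        = z , comp-≥ ≤⁺-refl xy yz , f
  sound ax (absˡ β≤α) x (y , xy , z , yz , f)        = z , comp-≥ β≤α xy yz , f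
  sound ax (absʳ β≤α) x (y , xy , z , yz , f)        = z , comp-≤ β≤α xy yz , f
  sound ax (J β<α)    x ((y , xy , f) , z , xz , g)  = y , xy , f , z , eucl β<α xy xz , g

  -- Persistence is assumed for variables only. Diamonds need no induction hypothesis: an `R ω` step
  -- followed by an `R α` step is an `R α` step, as `α` is at most `ω`.
  ω-reflects : Persistent M → ∀ A {x y} → R ω y x → _⊩_ M x A → _⊩_ M y A
  ω-reflects pe (var p)   yx f            = pe f yx
  ω-reflects pe ⊤         yx f            = tt
  ω-reflects pe (A ∧ B)   yx (f , g)      = ω-reflects pe A yx f , ω-reflects pe B yx g
  ω-reflects pe (⟨ α ⟩ A) yx (z , xz , f) = z , comp-≥ (α ≤⊤⁺) yx xz , f

RC-sound : ∀ {ℓ} {M : Model ℓ} → IsRC M → ∀ {A B} → RC-Axioms A B → True M A B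
RC-sound isRC (mono β<α) x (y , xy , f) = y , IsRC.incl isRC β<α xy , f

RCω-sound : ∀ {ℓ} {M : Model ℓ} → IsRC M → Persistent M → ∀ {A B} → RCω-Axioms A B → True M A B
RCω-sound isRC pe (rc a)         x f            = RC-sound isRC a x f
RCω-sound isRC pe (pers {A = A}) x (y , xy , f) = Soundness.ω-reflects (IsRC.isRJ isRC) pe A xy f

data DiamondsBelow (α : Modality) : Formula → Set where
  ⊤    : DiamondsBelow α ⊤
  _∧_  : ∀ {A B} → DiamondsBelow α A → DiamondsBelow α B → DiamondsBelow α (A ∧ B)
  ⟨_⟩_ : ∀ {β} → β <⁺ α → ∀ A → DiamondsBelow α (⟨ β ⟩ A)

module Canonical (Ax : Axioms) where

  infix 4 _⊢_ _∋_

  _⊢_ : Formula → Formula → Set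
  A ⊢ B = RJ+ Ax ∋ A ⊢ B

  J* : ∀ {α A D} → DiamondsBelow α D → ⟨ α ⟩ A ∧ D ⊢ ⟨ α ⟩ (A ∧ D)
  J* ⊤           = cut ∧-el (nec (∧-i refl top))
  -- `D` is absorbed first while `E` stays outside; then `E` is absorbed into the enlarged diamond,
  -- and the result is reassociated under it.
  J* (D ∧ E)     = cut
    (cut (∧-i (cut (∧-i ∧-el (cut ∧-er ∧-el)) (J* D)) (cut ∧-er ∧-er)) (J* E))
    (nec (∧-i (cut ∧-el ∧-el) (∧-i (cut ∧-el ∧-er) ∧-er)))
  J* (⟨ β<α ⟩ B) = J β<α

  ⟨⟩⟨⟩⊢⟨⊓⟩ : ∀ α β {A} → ⟨ α ⟩ ⟨ β ⟩ A ⊢ ⟨ α ⊓ β ⟩ A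
  -- `_⊓_` is itself defined by cases on `total`, so this split also reduces `α ⊓ β` in the goal.
  ⟨⟩⟨⟩⊢⟨⊓⟩ α β with total α β
  ... | inj₁ α≤β = absʳ α≤β
  ... | inj₂ β≤α = absˡ β≤α

  data Theory : Set where
    generated : Formula → Theory
    successor : Modality → Theory → Formula → Theory

  _∋_ : Theory → Formula → Set
  generated A     ∋ C = A ⊢ C
  successor α x A ∋ C = ∃[ D ] DiamondsBelow α D × (x ∋ D) × (A ∧ D ⊢ C)

  ∋-⊢ : ∀ x {A B} → x ∋ A → A ⊢ B → x ∋ B
  ∋-⊢ (generated _)     d                  e = cut d e
  ∋-⊢ (successor _ _ _) (D , low , xD , d) e = D , low , xD , cut d e

  ∋-⊤ : ∀ x → x ∋ ⊤
  ∋-⊤ (generated _)     = top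
  ∋-⊤ (successor _ x _) = ⊤ , ⊤ , ∋-⊤ x , top

  ∋-∧ : ∀ x {A B} → x ∋ A → x ∋ B → x ∋ A ∧ B
  ∋-∧ (generated _)     d                  e                  = ∧-i d e
  ∋-∧ (successor _ x _) (D , low , xD , d) (E , low′ , xE , e) =
    D ∧ E , low ∧ low′ , ∋-∧ x xD xE ,
    ∧-i (cut (∧-i ∧-el (cut ∧-er ∧-el)) d) (cut (∧-i ∧-el (cut ∧-er ∧-er)) e)

  record Rᶜ (α : Modality) (x y : Theory) : Set where
    field
      diamond  : ∀ {C} → y ∋ C → x ∋ ⟨ α ⟩ C
      preserve : ∀ {β C} → β <⁺ α → x ∋ ⟨ β ⟩ C → y ∋ ⟨ β ⟩ C
  open Rᶜ

  Rᶜ-comp : ∀ {α β x y z} → Rᶜ α x y → Rᶜ β y z → Rᶜ (α ⊓ β) x z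
  Rᶜ-comp {α} {β} {x} xy yz = record
    { diamond  = λ zC → ∋-⊢ x (diamond xy (diamond yz zC)) (⟨⟩⟨⟩⊢⟨⊓⟩ α β)
    ; preserve = λ γ< xC → preserve yz (<⁺-≤⁺-trans γ< (x⊓y≤y α β))
                             (preserve xy (<⁺-≤⁺-trans γ< (x⊓y≤x α β)) xC)
    }

  -- Both fields pass through `x`. If `C` is in `z`, then `⟨ β ⟩ C` is in `x` and is preserved into
  -- `y`. If `⟨ γ ⟩ C` is in `y`, then `⟨ α ⟩ ⟨ γ ⟩ C` is in `x`, absorption yields `⟨ γ ⟩ C` in
  -- `x`, and this is preserved into `z`.
  Rᶜ-eucl : ∀ {α β x y z} → β <⁺ α → Rᶜ α x y → Rᶜ β x z → Rᶜ β y z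
  Rᶜ-eucl {x = x} β<α xy xz = record
    { diamond  = λ zC → preserve xy β<α (diamond xz zC)
    ; preserve = λ γ<β yC → preserve xz γ<β
        (∋-⊢ x (diamond xy yC) (absˡ (<⁺⇒≤⁺ (<⁺-≤⁺-trans γ<β (<⁺⇒≤⁺ β<α)))))
    }

  Rᶜ-successor : ∀ {α x A} → x ∋ ⟨ α ⟩ A → Rᶜ α x (successor α x A)
  Rᶜ-successor {x = x} xαA = record
    { diamond  = λ (D , low , xD , d) → ∋-⊢ x (∋-∧ x xαA xD) (cut (J* low) (nec d))
    -- The single diamond `⟨ β ⟩ C` serves as the conjunction `D`.
    ; preserve = λ β<α xC → _ , ⟨ β<α ⟩ _ , xC , ∧-er
    }

  module _ (ℓ : Level) where

    model : Model ℓ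
    model = record
      { W        = Lift ℓ Theory
      ; nonempty = lift (generated ⊤)
      ; R        = λ α x y → Lift ℓ (Rᶜ α (lower x) (lower y))
      ; V        = λ x p → Lift ℓ (lower x ∋ var p)
      }

    isRJ : IsRJ model
    isRJ = record
      { comp = λ xy yz → lift (Rᶜ-comp (lower xy) (lower yz))
      ; eucl = λ β<α xy xz → lift (Rᶜ-eucl β<α (lower xy) (lower xz))
      }

    isRC : (∀ {A B} → RC-Axioms A B → A ⊢ B) → IsRC model
    isRC ax = record
      { isRJ = isRJ
      ; incl = λ {_} {_} {x} β<α xy → lift (record
          { diamond  = λ yC → ∋-⊢ (lower x) (diamond (lower xy) yC) (ax (mono β<α))
          -- A smaller index has fewer diamonds to preserve, so only `diamond` calls on the axiom.
          ; preserve = λ γ<β → preserve (lower xy) (<⁺-≤⁺-trans γ<β (<⁺⇒≤⁺ β<α))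
          })
      }

    persistent : (∀ {A} → ⟨ ω ⟩ A ⊢ A) → Persistent model
    persistent ax {y = y} xp yx = lift (∋-⊢ (lower y) (diamond (lower yx) (lower xp)) ax)

    -- One half of the truth lemma, by induction on the formula with the theory varying; this half
    -- needs the successor theories as witnesses for diamonds.
    ∋⇒⊩ : ∀ A x → x ∋ A → _⊩_ model (lift x) A
    ∋⇒⊩ (var p)   x xA = lift xA
    ∋⇒⊩ ⊤         x xA = tt
    ∋⇒⊩ (A ∧ B)   x xA = ∋⇒⊩ A x (∋-⊢ x xA ∧-el) , ∋⇒⊩ B x (∋-⊢ x xA ∧-er)
    ∋⇒⊩ (⟨ α ⟩ A) x xA =
      lift (successor α x A) , lift (Rᶜ-successor xA) ,
      -- The empty conjunction `⊤` puts `A` itself into the successor.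
      ∋⇒⊩ A (successor α x A) (⊤ , ⊤ , ∋-⊤ x , ∧-el)

    ⊩⇒∋ : ∀ A x → _⊩_ model (lift x) A → x ∋ A
    ⊩⇒∋ (var p)   x f                  = lower f
    ⊩⇒∋ ⊤         x f                  = ∋-⊤ x
    ⊩⇒∋ (A ∧ B)   x (f , g)            = ∋-∧ x (⊩⇒∋ A x f) (⊩⇒∋ B x g)
    ⊩⇒∋ (⟨ α ⟩ A) x (lift y , xy , f) = diamond (lower xy) (⊩⇒∋ A y f)

    -- Evaluated at the theory generated by `A`, where membership of `B` is by definition
    -- derivability from `A`.
    complete : ∀ {A B} → True model A B → A ⊢ B
    complete {A} {B} t = ⊩⇒∋ B (generated A) (t (lift (generated A)) (∋⇒⊩ A (generated A) refl))

RCω-soundness : ∀ {ℓ A B} → A ⊢RCω B → (M : Model ℓ) → IsRC M → Persistent M → True M A B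
RCω-soundness d M isRC pe = Soundness.sound (IsRC.isRJ isRC) (RCω-sound isRC pe) d

RCω-completeness : ∀ {ℓ A B} → ((M : Model ℓ) → IsRC M → Persistent M → True M A B) → A ⊢RCω B
RCω-completeness {ℓ} t =
  complete ℓ (t (model ℓ) (isRC ℓ (λ a → axiom (rc a))) (persistent ℓ (axiom pers)))
  where open Canonical RCω-Axioms

theorem4p1 : (ℓ : Level) (A B : Formula) →
    ((A ⊢RJ B) ⇔ ((M : Model ℓ) → IsRJ M → True M A B))
    × ((A ⊢RC B) ⇔ ((M : Model ℓ) → IsRC M → True M A B))
    × ((A ⊢RCω B) ⇔ ((M : Model ℓ) → IsRC M → Persistent M → True M A B))
theorem4p1 ℓ A B =
    mk⇔ (λ d M isRJ → Soundness.sound isRJ (λ ()) d)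
        (λ t → let open Canonical ∅-Axioms in complete ℓ (t (model ℓ) (isRJ ℓ)))
  , mk⇔ (λ d M isRC → Soundness.sound (IsRC.isRJ isRC) (RC-sound isRC) d)
        (λ t → let open Canonical RC-Axioms in complete ℓ (t (model ℓ) (isRC ℓ axiom)))
  , mk⇔ RCω-soundness RCω-completeness
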